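{- Let $\mathbf{C}$ be one of $\mathbf{DPMet}_{\mathcal V},\mathbf{PMet}_{\mathcal V},\mathbf{Met}_{\mathcal V}$, let $F\colon\mathbf C\to\mathbf C$ be a functor, $T$ a monad on $\mathbf C$, $\zeta\colon TF\Rightarrow FT$ an Eilenberg-Moore distributive law with induced lifting $\tilde F$ of $F$ to the category of $T$-algebras, and $(\Omega,o)$ a $T$-algebra. (1) If $\lambda\colon FT\Omega\to\Omega$ is a modal operator for a graded logic with truth value object $(\Omega,o)$ for the graded semantics $(\mathrm{id},\mathbb M_\zeta)$, then $\lambda=\mathrm{ev}_\lambda\cdot Fo$ for some $T$-algebra homomorphism $\mathrm{ev}_\lambda\colon\tilde F(\Omega,o)\to(\Omega,o)$. (2) Conversely, for every $T$-algebra homomorphism $e\colon\tilde F(\Omega,o)\to(\Omega,o)$, the morphism $e\cdot Fo\colon FT\Omega\to\Omega$ is a modal operator for a graded logic with truth value object $(\Omega,o)$ for $(\mathrm{id},\mathbb M_\zeta)$.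
   Context: A (commutative unital) quantale $\mathcal V=(V,\otimes,k,\le)$ is a complete lattice with a commutative monoid structure $(\otimes,k)$ such that each $-\otimes v$ preserves arbitrary joins. A $\mathcal V$-category $(X,d_X)$ is a set with $d_X\colon X\times X\to V$ such that $k\le d_X(x,x)$ and $d_X(x,y)\otimes d_X(y,z)\le d_X(x,z)$; it is symmetric if $d_X(x,y)=d_X(y,x)$, and separated if $k\le d_X(x,y)$ implies $x=y$. A $\mathcal V$-functor is a map $f$ with $d_X(a,b)\le d_Y(f(a),f(b))$. $\mathbf{DPMet}_{\mathcal V}$ is the category of $\mathcal V$-categories and $\mathcal V$-functors; $\mathbf{PMet}_{\mathcal V}$, $\mathbf{Met}_{\mathcal V}$ are the full subcategories of symmetric, respectively symmetric and separated, $\mathcal V$-categories. An Eilenberg-Moore (EM) distributive law of a monad $(T,\mu,\eta)$ over $F$ is a natural transformation $\zeta\colon TF\Rightarrow FT$ with $\zeta\cdot\eta F=F\eta$ and $\zeta\cdot\mu F=F\mu\cdot\zeta T\cdot T\zeta$. It induces the lifting $\tilde F$ of $F$ to the Eilenberg-Moore category of $T$, given by $\tilde F(A,a)=(FA,Fa\cdot\zeta_A)$ and $\tilde Fh=Fh$. The graded monad $\mathbb M_\zeta$ has $M_n=F^nT$; its unit is that of $T$, and its multiplications $\mu^{m,n}\colon M_mM_n\Rightarrow M_{m+n}$ are $\mu^{m,n}=F^{m+n}\mu\cdot F^m\zeta^{(n)}T$ with $\zeta^{(0)}=\mathrm{id}$, $\zeta^{(n+1)}=F\zeta^{(n)}\cdot\zeta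 F^n$; in particular $\mu^{1,0}=F\mu$ and $\mu^{0,1}=F\mu\cdot\zeta T$. A morphism $\lambda\colon FT\Omega\to\Omega$ is a (unary) modal operator for a graded logic with truth value object $(\Omega,o)$ for $(\mathrm{id},\mathbb M_\zeta)$ if $(\Omega,\Omega,o,o,\lambda)$ is an $M_1$-algebra for $\mathbb M_\zeta$, that is: $\lambda\cdot F\mu_\Omega=\lambda\cdot FTo$ (coequalization) and $\lambda\cdot F\mu_\Omega\cdot\zeta_{T\Omega}=o\cdot T\lambda$ (homomorphy). -}

module Defs where

open import Level using (Level; _⊔_; suc)
open import Algebra.Structures using (IsCommutativeMonoid)
open import Data.Nat.Base as ℕ using (ℕ; zero)
open import Data.Nat.Properties using (+-assoc; +-identityʳ)
open import Data.Product.Base using (Σ; _×_; proj₁)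
open import Function.Bundles using (Func)
import Function.Construct.Composition as Composition
import Function.Construct.Identity as Identity
open import Relation.Binary.Bundles using (Setoid)
open import Relation.Binary.PropositionalEquality.Core using (_≡_; refl)
open import Relation.Binary.Structures using (IsEquivalence; IsPartialOrder)
import Relation.Binary.Reasoning.Setoid as SetoidReasoning

private
  variable
    o ℓ e : Level

-- Hom-sets are setoids, as there are no quotients and no function
-- extensionality.
record Category (o ℓ e : Level) : Set (suc (o ⊔ ℓ ⊔ e)) where
  infix  4 _≈_ _⇒_
  infixr 9 _∘_
  field
    Obj       : Set o
    _⇒_       : Obj → Obj → Set ℓ
    _≈_       : ∀ {A B} → A ⇒ B → A ⇒ B → Set e
    id        : ∀ {A} → A ⇒ A
    _∘_       : ∀ {A B C} → B ⇒ C → A ⇒ B → A ⇒ C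
    equiv     : ∀ {A B} → IsEquivalence (_≈_ {A} {B})
    ∘-resp-≈  : ∀ {A B C} {f f′ : B ⇒ C} {g g′ : A ⇒ B} →
                f ≈ f′ → g ≈ g′ → f ∘ g ≈ f′ ∘ g′
    identityˡ : ∀ {A B} {f : A ⇒ B} → id ∘ f ≈ f
    identityʳ : ∀ {A B} {f : A ⇒ B} → f ∘ id ≈ f
    assoc     : ∀ {A B C D} {f : C ⇒ D} {g : B ⇒ C} {h : A ⇒ B} →
                (f ∘ g) ∘ h ≈ f ∘ (g ∘ h)

  module Equiv {A B : Obj} = IsEquivalence (equiv {A} {B})

  homSetoid : (A B : Obj) → Setoid ℓ e
  homSetoid A B = record { Carrier = A ⇒ B ; _≈_ = _≈_ ; isEquivalence = equiv }

  module HomReasoning {A B : Obj} = SetoidReasoning (homSetoid A B)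

  ∘-congˡ : ∀ {A B C} {f : B ⇒ C} {g g′ : A ⇒ B} → g ≈ g′ → f ∘ g ≈ f ∘ g′
  ∘-congˡ p = ∘-resp-≈ Equiv.refl p

  ∘-congʳ : ∀ {A B C} {f f′ : B ⇒ C} {g : A ⇒ B} → f ≈ f′ → f ∘ g ≈ f′ ∘ g
  ∘-congʳ p = ∘-resp-≈ p Equiv.refl

  pullˡ : ∀ {A B C D} {f : C ⇒ D} {g : B ⇒ C} {fg : B ⇒ D} {h : A ⇒ B} →
          f ∘ g ≈ fg → f ∘ (g ∘ h) ≈ fg ∘ h
  pullˡ p = Equiv.trans (Equiv.sym assoc) (∘-congʳ p)

  extendʳ : ∀ {A B B′ C D} {f : C ⇒ D} {g : B ⇒ C} {f′ : B′ ⇒ D} {g′ : B ⇒ B′}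
            {h : A ⇒ B} → f ∘ g ≈ f′ ∘ g′ → f ∘ (g ∘ h) ≈ f′ ∘ (g′ ∘ h)
  extendʳ p = Equiv.trans (pullˡ p) assoc

FullSubcategory : ∀ {p} (C : Category o ℓ e) → (Category.Obj C → Set p) →
                  Category (o ⊔ p) ℓ e
FullSubcategory C P = record
  { Obj       = Σ Obj P
  ; _⇒_       = λ A B → proj₁ A ⇒ proj₁ B
  ; _≈_       = _≈_
  ; id        = id
  ; _∘_       = _∘_
  ; equiv     = equiv
  ; ∘-resp-≈  = ∘-resp-≈
  ; identityˡ = identityˡ
  ; identityʳ = identityʳ
  ; assoc     = assoc
  }
  where open Category C

record Functor {o ℓ e o′ ℓ′ e′} (C : Category o ℓ e) (D : Category o′ ℓ′ e′) :
               Set (o ⊔ ℓ ⊔ e ⊔ o′ ⊔ ℓ′ ⊔ e′) where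
  private
    module C = Category C
    module D = Category D
  field
    F₀           : C.Obj → D.Obj
    F₁           : ∀ {A B} → A C.⇒ B → F₀ A D.⇒ F₀ B
    F-resp-≈     : ∀ {A B} {f g : A C.⇒ B} → f C.≈ g → F₁ f D.≈ F₁ g
    identity     : ∀ {A} → F₁ (C.id {A}) D.≈ D.id
    homomorphism : ∀ {X Y Z} {f : X C.⇒ Y} {g : Y C.⇒ Z} →
                   F₁ (g C.∘ f) D.≈ F₁ g D.∘ F₁ f

  F-square : ∀ {X Y Y′ Z} {f : Y C.⇒ Z} {g : X C.⇒ Y}
             {f′ : Y′ C.⇒ Z} {g′ : X C.⇒ Y′} →
             f C.∘ g C.≈ f′ C.∘ g′ → F₁ f D.∘ F₁ g D.≈ F₁ f′ D.∘ F₁ g′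
  F-square p =
    D.Equiv.trans (D.Equiv.sym homomorphism) (D.Equiv.trans (F-resp-≈ p) homomorphism)

Endofunctor : Category o ℓ e → Set (o ⊔ ℓ ⊔ e)
Endofunctor C = Functor C C

idF : {C : Category o ℓ e} → Functor C C
idF {C = C} = record
  { F₀ = λ A → A
  ; F₁ = λ f → f
  ; F-resp-≈ = λ p → p
  ; identity = Equiv.refl
  ; homomorphism = Equiv.refl
  }
  where open Category C

infixr 9 _∘F_
_∘F_ : ∀ {o ℓ e o′ ℓ′ e′ o″ ℓ″ e″} {C : Category o ℓ e} {D : Category o′ ℓ′ e′}
       {E : Category o″ ℓ″ e″} → Functor D E → Functor C D → Functor C E
_∘F_ {E = E} G F = record
  { F₀ = λ A → G.F₀ (F.F₀ A)
  ; F₁ = λ f → G.F₁ (F.F₁ f)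
  ; F-resp-≈ = λ p → G.F-resp-≈ (F.F-resp-≈ p)
  ; identity = E.Equiv.trans (G.F-resp-≈ F.identity) G.identity
  ; homomorphism = E.Equiv.trans (G.F-resp-≈ F.homomorphism) G.homomorphism
  }
  where
    module G = Functor G
    module F = Functor F
    module E = Category E

record NaturalTransformation {o ℓ e o′ ℓ′ e′} {C : Category o ℓ e} {D : Category o′ ℓ′ e′}
                             (F G : Functor C D) : Set (o ⊔ ℓ ⊔ ℓ′ ⊔ e′) where
  private
    module C = Category C
    module F = Functor F
    module G = Functor G
  open Category D
  field
    at      : ∀ A → F.F₀ A ⇒ G.F₀ A
    natural : ∀ {A B} (f : A C.⇒ B) → at B ∘ F.F₁ f ≈ G.F₁ f ∘ at A

record Monad (C : Category o ℓ e) : Set (o ⊔ ℓ ⊔ e) where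
  open Category C
  field
    T    : Endofunctor C
    η-NT : NaturalTransformation idF T
    μ-NT : NaturalTransformation (T ∘F T) T
  open Functor T public using () renaming (F₀ to T₀; F₁ to T₁)
  open NaturalTransformation η-NT public using () renaming (at to η; natural to η-natural)
  open NaturalTransformation μ-NT public using () renaming (at to μ; natural to μ-natural)
  field
    μ-identityˡ : ∀ {A} → μ A ∘ T₁ (η A) ≈ id
    μ-identityʳ : ∀ {A} → μ A ∘ η (T₀ A) ≈ id
    μ-assoc     : ∀ {A} → μ A ∘ T₁ (μ A) ≈ μ A ∘ μ (T₀ A)

record Algebra {C : Category o ℓ e} (M : Monad C) : Set (o ⊔ ℓ ⊔ e) where
  open Category C
  open Monad M
  field
    carrier  : Obj
    act      : T₀ carrier ⇒ carrier
    act-unit : act ∘ η carrier ≈ id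
    act-mult : act ∘ μ carrier ≈ act ∘ T₁ act

record AlgebraHom {C : Category o ℓ e} {M : Monad C} (A B : Algebra M) : Set (ℓ ⊔ e) where
  open Category C
  open Monad M
  private
    module A = Algebra A
    module B = Algebra B
  field
    hom      : A.carrier ⇒ B.carrier
    preserve : hom ∘ A.act ≈ B.act ∘ T₁ hom

EilenbergMoore : {C : Category o ℓ e} → Monad C → Category (o ⊔ ℓ ⊔ e) (ℓ ⊔ e) e
EilenbergMoore {C = C} M = record
  { Obj = Algebra M
  ; _⇒_ = AlgebraHom
  ; _≈_ = λ f g → hom f ≈ hom g
  ; id = record
    { hom = id
    ; preserve = Equiv.trans identityˡ
        (Equiv.sym (Equiv.trans (∘-congˡ (Functor.identity T)) identityʳ))
    }
  ; _∘_ = λ {A} {B} {D} g f → record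
    { hom = hom g ∘ hom f
    ; preserve = begin
        (hom g ∘ hom f) ∘ act A             ≈⟨ assoc ⟩
        hom g ∘ (hom f ∘ act A)             ≈⟨ ∘-congˡ (preserve f) ⟩
        hom g ∘ (act B ∘ T₁ (hom f))        ≈⟨ extendʳ (preserve g) ⟩
        act D ∘ (T₁ (hom g) ∘ T₁ (hom f))   ≈⟨ ∘-congˡ (Functor.homomorphism T) ⟨
        act D ∘ T₁ (hom g ∘ hom f)          ∎
    }
  ; equiv = record { refl = Equiv.refl ; sym = Equiv.sym ; trans = Equiv.trans }
  ; ∘-resp-≈ = ∘-resp-≈
  ; identityˡ = identityˡ
  ; identityʳ = identityʳ
  ; assoc = assoc
  }
  where
    open Category C
    open Monad M
    open Algebra
    open AlgebraHom
    open HomReasoning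

record EMLaw {C : Category o ℓ e} (M : Monad C) (F : Endofunctor C) : Set (o ⊔ ℓ ⊔ e) where
  open Category C
  open Monad M
  open Functor F
  field
    ζ-NT : NaturalTransformation (T ∘F F) (F ∘F T)
  open NaturalTransformation ζ-NT public using () renaming (at to ζ; natural to ζ-natural)
  field
    ζ-unit : ∀ {A} → ζ A ∘ η (F₀ A) ≈ F₁ (η A)
    ζ-mult : ∀ {A} → ζ A ∘ μ (F₀ A) ≈ F₁ (μ A) ∘ (ζ (T₀ A) ∘ T₁ (ζ A))

lifting : {C : Category o ℓ e} {M : Monad C} {F : Endofunctor C} →
          EMLaw M F → Endofunctor (EilenbergMoore M)
lifting {C = C} {M} {F} law = record
  { F₀ = λ A → record
    { carrier = F₀ (carrier A)
    ; act = F₁ (act A) ∘ ζ (carrier A)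
    ; act-unit = begin
        (F₁ (act A) ∘ ζ _) ∘ η _   ≈⟨ assoc ⟩
        F₁ (act A) ∘ (ζ _ ∘ η _)   ≈⟨ ∘-congˡ ζ-unit ⟩
        F₁ (act A) ∘ F₁ (η _)      ≈⟨ homomorphism ⟨
        F₁ (act A ∘ η _)           ≈⟨ F-resp-≈ (act-unit A) ⟩
        F₁ id                      ≈⟨ identity ⟩
        id                         ∎
    ; act-mult = begin
        (F₁ (act A) ∘ ζ _) ∘ μ _                         ≈⟨ assoc ⟩
        F₁ (act A) ∘ (ζ _ ∘ μ _)                         ≈⟨ ∘-congˡ ζ-mult ⟩
        F₁ (act A) ∘ (F₁ (μ _) ∘ (ζ _ ∘ T₁ (ζ _)))       ≈⟨ extendʳ (F-square (act-mult A)) ⟩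
        F₁ (act A) ∘ (F₁ (T₁ (act A)) ∘ (ζ _ ∘ T₁ (ζ _))) ≈⟨ ∘-congˡ (extendʳ (ζ-natural (act A))) ⟨
        F₁ (act A) ∘ (ζ _ ∘ (T₁ (F₁ (act A)) ∘ T₁ (ζ _))) ≈⟨ assoc ⟨
        (F₁ (act A) ∘ ζ _) ∘ (T₁ (F₁ (act A)) ∘ T₁ (ζ _)) ≈⟨ ∘-congˡ (Functor.homomorphism T) ⟨
        (F₁ (act A) ∘ ζ _) ∘ T₁ (F₁ (act A) ∘ ζ _)       ∎
    }
  ; F₁ = λ {A} {B} h → record
    { hom = F₁ (hom h)
    ; preserve = begin
        F₁ (hom h) ∘ (F₁ (act A) ∘ ζ _)            ≈⟨ extendʳ (F-square (preserve h)) ⟩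
        F₁ (act B) ∘ (F₁ (T₁ (hom h)) ∘ ζ _)       ≈⟨ ∘-congˡ (ζ-natural (hom h)) ⟨
        F₁ (act B) ∘ (ζ _ ∘ T₁ (F₁ (hom h)))       ≈⟨ assoc ⟨
        (F₁ (act B) ∘ ζ _) ∘ T₁ (F₁ (hom h))       ∎
    }
  ; F-resp-≈ = F-resp-≈
  ; identity = identity
  ; homomorphism = homomorphism
  }
  where
    open Category C
    open Monad M
    open Functor F
    open EMLaw law
    open Algebra
    open AlgebraHom
    open HomReasoning

-- The identity G i A = G j A for i ≡ j; needed in the laws of a graded monad
-- because n + 0 and (k + m) + n do not reduce to n and k + (m + n).
reindex : {C : Category o ℓ e} (let open Category C) (G : ℕ → Endofunctor C) →
          ∀ {i j A} → i ≡ j → Functor.F₀ (G i) A ⇒ Functor.F₀ (G j) A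
reindex {C = C} G refl = Category.id C

record GradedMonad (C : Category o ℓ e) : Set (o ⊔ ℓ ⊔ e) where
  open Category C
  field
    M    : ℕ → Endofunctor C
    η-NT : NaturalTransformation idF (M 0)
    μ-NT : ∀ m n → NaturalTransformation (M m ∘F M n) (M (m ℕ.+ n))

  M₀ : ℕ → Obj → Obj
  M₀ n = Functor.F₀ (M n)
  M₁ : ∀ n {A B} → A ⇒ B → M₀ n A ⇒ M₀ n B
  M₁ n = Functor.F₁ (M n)
  η : ∀ A → A ⇒ M₀ 0 A
  η = NaturalTransformation.at η-NT
  μ : ∀ m n A → M₀ m (M₀ n A) ⇒ M₀ (m ℕ.+ n) A
  μ m n = NaturalTransformation.at (μ-NT m n)

  field
    graded-unitˡ : ∀ {n A} → μ 0 n A ∘ η (M₀ n A) ≈ id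
    graded-unitʳ : ∀ {n A} → reindex M (+-identityʳ n) ∘ (μ n 0 A ∘ M₁ n (η A)) ≈ id
    graded-assoc : ∀ {k m n A} →
      reindex M (+-assoc k m n) ∘ (μ (k ℕ.+ m) n A ∘ μ k m (M₀ n A)) ≈
      μ k (m ℕ.+ n) A ∘ M₁ k (μ m n A)

module _ {C : Category o ℓ e} (𝕄 : GradedMonad C) where
  open Category C
  open GradedMonad 𝕄

  -- A tuple (A₀, A₁, a⁰⁰, a⁰¹, a¹⁰) with structure maps aᵐᵏ : Mₘ Aₖ ⇒ Aₘ₊ₖ.
  record IsM₁Algebra (A₀ A₁ : Obj) (a⁰⁰ : M₀ 0 A₀ ⇒ A₀) (a⁰¹ : M₀ 0 A₁ ⇒ A₁)
                     (a¹⁰ : M₀ 1 A₀ ⇒ A₁) : Set e where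
    field
      unit⁰          : a⁰⁰ ∘ η A₀ ≈ id
      unit¹          : a⁰¹ ∘ η A₁ ≈ id
      assoc⁰         : a⁰⁰ ∘ μ 0 0 A₀ ≈ a⁰⁰ ∘ M₁ 0 a⁰⁰
      assoc¹         : a⁰¹ ∘ μ 0 0 A₁ ≈ a⁰¹ ∘ M₁ 0 a⁰¹
      homomorphy     : a¹⁰ ∘ μ 0 1 A₀ ≈ a⁰¹ ∘ M₁ 0 a¹⁰
      coequalization : a¹⁰ ∘ μ 1 0 A₀ ≈ a¹⁰ ∘ M₁ 1 a⁰⁰

infixl 10 _^F_
_^F_ : {C : Category o ℓ e} → Endofunctor C → ℕ → Endofunctor C
F ^F zero    = idF
F ^F ℕ.suc n = F ∘F (F ^F n)

module _ {C : Category o ℓ e} {M : Monad C} {F : Endofunctor C} (law : EMLaw M F) where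
  open Category C
  open Monad M
  open Functor F
  open EMLaw law
  open HomReasoning
  private
    module T = Functor T
    module Fⁿ (n : ℕ) = Functor (F ^F n)

  iterate : ∀ n → EMLaw M (F ^F n)
  iterate zero = record
    { ζ-NT = record
      { at = λ A → id
      ; natural = λ f → Equiv.trans identityˡ (Equiv.sym identityʳ)
      }
    ; ζ-unit = identityˡ
    ; ζ-mult = Equiv.trans identityˡ (Equiv.sym (Equiv.trans
        (∘-congˡ (Equiv.trans identityˡ T.identity)) identityʳ))
    }
  iterate (ℕ.suc n) = record
    { ζ-NT = record
      { at = λ A → F₁ (ζⁿ A) ∘ ζ (Fⁿ.F₀ n A)
      ; natural = λ f → begin
          (F₁ (ζⁿ _) ∘ ζ _) ∘ T₁ (F₁ (Fⁿ.F₁ n f))   ≈⟨ assoc ⟩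
          F₁ (ζⁿ _) ∘ (ζ _ ∘ T₁ (F₁ (Fⁿ.F₁ n f)))   ≈⟨ ∘-congˡ (ζ-natural _) ⟩
          F₁ (ζⁿ _) ∘ (F₁ (T₁ (Fⁿ.F₁ n f)) ∘ ζ _)   ≈⟨ extendʳ (F-square (ζⁿ-natural f)) ⟩
          F₁ (Fⁿ.F₁ n (T₁ f)) ∘ (F₁ (ζⁿ _) ∘ ζ _)   ∎
      }
    ; ζ-unit = begin
        (F₁ (ζⁿ _) ∘ ζ _) ∘ η _   ≈⟨ assoc ⟩
        F₁ (ζⁿ _) ∘ (ζ _ ∘ η _)   ≈⟨ ∘-congˡ ζ-unit ⟩
        F₁ (ζⁿ _) ∘ F₁ (η _)      ≈⟨ homomorphism ⟨
        F₁ (ζⁿ _ ∘ η _)           ≈⟨ F-resp-≈ ζⁿ-unit ⟩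
        F₁ (Fⁿ.F₁ n (η _))        ∎
    ; ζ-mult = begin
        (F₁ (ζⁿ _) ∘ ζ _) ∘ μ _
          ≈⟨ assoc ⟩
        F₁ (ζⁿ _) ∘ (ζ _ ∘ μ _)
          ≈⟨ ∘-congˡ ζ-mult ⟩
        F₁ (ζⁿ _) ∘ (F₁ (μ _) ∘ (ζ _ ∘ T₁ (ζ _)))
          ≈⟨ extendʳ (F-square ζⁿ-mult) ⟩
        F₁ (Fⁿ.F₁ n (μ _)) ∘ (F₁ (ζⁿ _ ∘ T₁ (ζⁿ _)) ∘ (ζ _ ∘ T₁ (ζ _)))
          ≈⟨ ∘-congˡ (∘-congʳ homomorphism) ⟩
        F₁ (Fⁿ.F₁ n (μ _)) ∘ ((F₁ (ζⁿ _) ∘ F₁ (T₁ (ζⁿ _))) ∘ (ζ _ ∘ T₁ (ζ _)))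
          ≈⟨ ∘-congˡ assoc ⟩
        F₁ (Fⁿ.F₁ n (μ _)) ∘ (F₁ (ζⁿ _) ∘ (F₁ (T₁ (ζⁿ _)) ∘ (ζ _ ∘ T₁ (ζ _))))
          ≈⟨ ∘-congˡ (∘-congˡ (extendʳ (ζ-natural _))) ⟨
        F₁ (Fⁿ.F₁ n (μ _)) ∘ (F₁ (ζⁿ _) ∘ (ζ _ ∘ (T₁ (F₁ (ζⁿ _)) ∘ T₁ (ζ _))))
          ≈⟨ ∘-congˡ (∘-congˡ (∘-congˡ T.homomorphism)) ⟨
        F₁ (Fⁿ.F₁ n (μ _)) ∘ (F₁ (ζⁿ _) ∘ (ζ _ ∘ T₁ (F₁ (ζⁿ _) ∘ ζ _)))
          ≈⟨ ∘-congˡ assoc ⟨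
        F₁ (Fⁿ.F₁ n (μ _)) ∘ ((F₁ (ζⁿ _) ∘ ζ _) ∘ T₁ (F₁ (ζⁿ _) ∘ ζ _))
          ∎
    }
    where
      open EMLaw (iterate n) using ()
        renaming (ζ to ζⁿ; ζ-natural to ζⁿ-natural; ζ-unit to ζⁿ-unit; ζ-mult to ζⁿ-mult)

  private
    module Law n = EMLaw (iterate n)

    Mⁿ : ℕ → Endofunctor C
    Mⁿ n = (F ^F n) ∘F T

    module Mⁿ n = Functor (Mⁿ n)

  -- Fᵐ⁺ⁿμ · Fᵐζ⁽ⁿ⁾T is Fᵐ(Fⁿμ · ζ⁽ⁿ⁾T); applying Fᵐ by recursion on m
  -- makes the identification FᵐFⁿ = Fᵐ⁺ⁿ definitional.
  graded-μ : ∀ m n → NaturalTransformation (Mⁿ m ∘F Mⁿ n) (Mⁿ (m ℕ.+ n))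
  graded-μ zero n = record
    { at = λ A → Fⁿ.F₁ n (μ A) ∘ Law.ζ n (T₀ A)
    ; natural = λ f → begin
        (Fⁿ.F₁ n (μ _) ∘ Law.ζ n _) ∘ T₁ (Fⁿ.F₁ n (T₁ f))
          ≈⟨ assoc ⟩
        Fⁿ.F₁ n (μ _) ∘ (Law.ζ n _ ∘ T₁ (Fⁿ.F₁ n (T₁ f)))
          ≈⟨ ∘-congˡ (Law.ζ-natural n _) ⟩
        Fⁿ.F₁ n (μ _) ∘ (Fⁿ.F₁ n (T₁ (T₁ f)) ∘ Law.ζ n _)
          ≈⟨ extendʳ (Fⁿ.F-square n (μ-natural f)) ⟩
        Fⁿ.F₁ n (T₁ f) ∘ (Fⁿ.F₁ n (μ _) ∘ Law.ζ n _)
          ∎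
    }
  graded-μ (ℕ.suc m) n = record
    { at = λ A → F₁ (μᵐⁿ.at A)
    ; natural = λ f → F-square (μᵐⁿ.natural f)
    }
    where module μᵐⁿ = NaturalTransformation (graded-μ m n)

  private
    μ′ : ∀ m n A → Mⁿ.F₀ m (Mⁿ.F₀ n A) ⇒ Mⁿ.F₀ (m ℕ.+ n) A
    μ′ m n = NaturalTransformation.at (graded-μ m n)

    μ′-suc : ∀ m A → μ′ 0 (ℕ.suc m) A ≈ F₁ (μ′ 0 m A) ∘ ζ (Mⁿ.F₀ m A)
    μ′-suc m A = begin
      F₁ (Fⁿ.F₁ m (μ A)) ∘ (F₁ (Law.ζ m (T₀ A)) ∘ ζ _)   ≈⟨ assoc ⟨
      (F₁ (Fⁿ.F₁ m (μ A)) ∘ F₁ (Law.ζ m (T₀ A))) ∘ ζ _   ≈⟨ ∘-congʳ homomorphism ⟨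
      F₁ (μ′ 0 m A) ∘ ζ _                                ∎

    unitˡ : ∀ n {A} → μ′ 0 n A ∘ η (Mⁿ.F₀ n A) ≈ id
    unitˡ n = begin
      (Fⁿ.F₁ n (μ _) ∘ Law.ζ n _) ∘ η _   ≈⟨ assoc ⟩
      Fⁿ.F₁ n (μ _) ∘ (Law.ζ n _ ∘ η _)   ≈⟨ ∘-congˡ (Law.ζ-unit n) ⟩
      Fⁿ.F₁ n (μ _) ∘ Fⁿ.F₁ n (η _)       ≈⟨ Fⁿ.homomorphism n ⟨
      Fⁿ.F₁ n (μ _ ∘ η _)                 ≈⟨ Fⁿ.F-resp-≈ n μ-identityʳ ⟩
      Fⁿ.F₁ n id                          ≈⟨ Fⁿ.identity n ⟩
      id                                  ∎

    reindex-suc : ∀ {i j A} (p : i ≡ j) (q : ℕ.suc i ≡ ℕ.suc j) →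
                  reindex Mⁿ {A = A} q ≈ F₁ (reindex Mⁿ {A = A} p)
    reindex-suc refl refl = Equiv.sym identity

    unitʳ : ∀ n {A} → reindex Mⁿ (+-identityʳ n) ∘ (μ′ n 0 A ∘ Mⁿ.F₁ n (η A)) ≈ id
    unitʳ zero = begin
      id ∘ ((μ _ ∘ id) ∘ T₁ (η _))   ≈⟨ identityˡ ⟩
      (μ _ ∘ id) ∘ T₁ (η _)          ≈⟨ ∘-congʳ identityʳ ⟩
      μ _ ∘ T₁ (η _)                 ≈⟨ μ-identityˡ ⟩
      id                             ∎
    unitʳ (ℕ.suc n) {A} = begin
      reindex Mⁿ (+-identityʳ (ℕ.suc n)) ∘ (F₁ (μ′ n 0 A) ∘ F₁ (Mⁿ.F₁ n (η A)))
        ≈⟨ ∘-resp-≈ (reindex-suc (+-identityʳ n) (+-identityʳ (ℕ.suc n))) (Equiv.sym homomorphism) ⟩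
      F₁ (reindex Mⁿ (+-identityʳ n)) ∘ F₁ (μ′ n 0 A ∘ Mⁿ.F₁ n (η A))
        ≈⟨ homomorphism ⟨
      F₁ (reindex Mⁿ (+-identityʳ n) ∘ (μ′ n 0 A ∘ Mⁿ.F₁ n (η A)))
        ≈⟨ F-resp-≈ (unitʳ n) ⟩
      F₁ id
        ≈⟨ identity ⟩
      id ∎

    assoc₀ : ∀ m n A → μ′ m n A ∘ μ′ 0 m (Mⁿ.F₀ n A) ≈ μ′ 0 (m ℕ.+ n) A ∘ T₁ (μ′ m n A)
    assoc₀ zero n A = begin
      (Fⁿ.F₁ n (μ A) ∘ Law.ζ n (T₀ A)) ∘ (μ _ ∘ id)
        ≈⟨ ∘-congˡ identityʳ ⟩
      (Fⁿ.F₁ n (μ A) ∘ Law.ζ n (T₀ A)) ∘ μ _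
        ≈⟨ assoc ⟩
      Fⁿ.F₁ n (μ A) ∘ (Law.ζ n (T₀ A) ∘ μ _)
        ≈⟨ ∘-congˡ (Law.ζ-mult n) ⟩
      Fⁿ.F₁ n (μ A) ∘ (Fⁿ.F₁ n (μ (T₀ A)) ∘ (Law.ζ n _ ∘ T₁ (Law.ζ n (T₀ A))))
        ≈⟨ extendʳ (Fⁿ.F-square n μ-assoc) ⟨
      Fⁿ.F₁ n (μ A) ∘ (Fⁿ.F₁ n (T₁ (μ A)) ∘ (Law.ζ n _ ∘ T₁ (Law.ζ n (T₀ A))))
        ≈⟨ ∘-congˡ (extendʳ (Law.ζ-natural n _)) ⟨
      Fⁿ.F₁ n (μ A) ∘ (Law.ζ n _ ∘ (T₁ (Fⁿ.F₁ n (μ A)) ∘ T₁ (Law.ζ n (T₀ A))))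
        ≈⟨ assoc ⟨
      (Fⁿ.F₁ n (μ A) ∘ Law.ζ n _) ∘ (T₁ (Fⁿ.F₁ n (μ A)) ∘ T₁ (Law.ζ n (T₀ A)))
        ≈⟨ ∘-congˡ T.homomorphism ⟨
      (Fⁿ.F₁ n (μ A) ∘ Law.ζ n _) ∘ T₁ (Fⁿ.F₁ n (μ A) ∘ Law.ζ n (T₀ A))
        ∎
    assoc₀ (ℕ.suc m) n A = begin
      F₁ (μ′ m n A) ∘ μ′ 0 (ℕ.suc m) (Mⁿ.F₀ n A)
        ≈⟨ ∘-congˡ (μ′-suc m _) ⟩
      F₁ (μ′ m n A) ∘ (F₁ (μ′ 0 m (Mⁿ.F₀ n A)) ∘ ζ _)
        ≈⟨ extendʳ (F-square (assoc₀ m n A)) ⟩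
      F₁ (μ′ 0 (m ℕ.+ n) A) ∘ (F₁ (T₁ (μ′ m n A)) ∘ ζ _)
        ≈⟨ ∘-congˡ (ζ-natural _) ⟨
      F₁ (μ′ 0 (m ℕ.+ n) A) ∘ (ζ _ ∘ T₁ (F₁ (μ′ m n A)))
        ≈⟨ assoc ⟨
      (F₁ (μ′ 0 (m ℕ.+ n) A) ∘ ζ _) ∘ T₁ (F₁ (μ′ m n A))
        ≈⟨ ∘-congʳ (μ′-suc (m ℕ.+ n) A) ⟨
      μ′ 0 (ℕ.suc m ℕ.+ n) A ∘ T₁ (F₁ (μ′ m n A))
        ∎

    assoc′ : ∀ k m n A →
      reindex Mⁿ (+-assoc k m n) ∘ (μ′ (k ℕ.+ m) n A ∘ μ′ k m (Mⁿ.F₀ n A)) ≈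
      μ′ k (m ℕ.+ n) A ∘ Mⁿ.F₁ k (μ′ m n A)
    assoc′ zero m n A = Equiv.trans identityˡ (assoc₀ m n A)
    assoc′ (ℕ.suc k) m n A = begin
      reindex Mⁿ (+-assoc (ℕ.suc k) m n) ∘ (F₁ (μ′ (k ℕ.+ m) n A) ∘ F₁ (μ′ k m (Mⁿ.F₀ n A)))
        ≈⟨ ∘-resp-≈ (reindex-suc (+-assoc k m n) (+-assoc (ℕ.suc k) m n)) (Equiv.sym homomorphism) ⟩
      F₁ (reindex Mⁿ (+-assoc k m n)) ∘ F₁ (μ′ (k ℕ.+ m) n A ∘ μ′ k m (Mⁿ.F₀ n A))
        ≈⟨ F-square (assoc′ k m n A) ⟩
      F₁ (μ′ k (m ℕ.+ n) A) ∘ F₁ (Mⁿ.F₁ k (μ′ m n A))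
        ∎

  gradedMonad : GradedMonad C
  gradedMonad = record
    { M = Mⁿ
    ; η-NT = record { at = η ; natural = η-natural }
    ; μ-NT = graded-μ
    ; graded-unitˡ = λ {n} → unitˡ n
    ; graded-unitʳ = λ {n} → unitʳ n
    ; graded-assoc = λ {k} {m} {n} {A} → assoc′ k m n A
    }

  -- For the graded semantics (id, 𝕄_ζ), whose first component id : FT ⇒ M₁
  -- only identifies FT with M₁.
  IsModalOperator : (Ωo : Algebra M) → let open Algebra Ωo renaming (carrier to Ω) in
                    F₀ (T₀ Ω) ⇒ Ω → Set e
  IsModalOperator Ωo lam = IsM₁Algebra gradedMonad carrier carrier act act lam
    where open Algebra Ωo

-- Arbitrary joins are joins of families indexed by types of an arbitrary
-- level ι (predicativity); subsets of the carrier are covered by taking ι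
-- large enough, and meets are joins of lower bounds.
record Quantale (c ℓ₁ ℓ₂ ι : Level) : Set (suc (c ⊔ ℓ₁ ⊔ ℓ₂ ⊔ ι)) where
  infix  4 _≈_ _≤_
  infixl 7 _⊗_
  field
    Carrier        : Set c
    _≈_            : Carrier → Carrier → Set ℓ₁
    _≤_            : Carrier → Carrier → Set ℓ₂
    isPartialOrder : IsPartialOrder _≈_ _≤_
    ⋁              : {I : Set ι} → (I → Carrier) → Carrier
    ⋁-upper        : ∀ {I : Set ι} (f : I → Carrier) i → f i ≤ ⋁ f
    ⋁-least        : ∀ {I : Set ι} (f : I → Carrier) u → (∀ i → f i ≤ u) → ⋁ f ≤ u
    _⊗_            : Carrier → Carrier → Carrier
    k              : Carrier
    isCommutativeMonoid : IsCommutativeMonoid _≈_ _⊗_ k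
    ⊗-distrib-⋁    : ∀ {I : Set ι} (f : I → Carrier) v → ⋁ f ⊗ v ≈ ⋁ (λ i → f i ⊗ v)

data MetricCategory : Set where
  dpmet pmet met : MetricCategory

module _ {c ℓ₁ ℓ₂ ι : Level} (𝒱 : Quantale c ℓ₁ ℓ₂ ι) where
  private module V = Quantale 𝒱

  record VCat (a b : Level) : Set (suc (a ⊔ b) ⊔ c ⊔ ℓ₁ ⊔ ℓ₂) where
    field
      X          : Setoid a b
    open Setoid X public using (_≈_) renaming (Carrier to ∣X∣)
    field
      d          : ∣X∣ → ∣X∣ → V.Carrier
      d-cong     : ∀ {x x′ y y′} → x ≈ x′ → y ≈ y′ → d x y V.≈ d x′ y′
      d-refl     : ∀ x → V.k V.≤ d x x
      d-triangle : ∀ x y z → d x y V.⊗ d y z V.≤ d x z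

  Symmetric : ∀ {a b} → VCat a b → Set (a ⊔ ℓ₁)
  Symmetric A = ∀ x y → d x y V.≈ d y x
    where open VCat A

  Separated : ∀ {a b} → VCat a b → Set (a ⊔ b ⊔ ℓ₂)
  Separated A = ∀ x y → V.k V.≤ d x y → x ≈ y
    where open VCat A

  record VFunctor {a b} (A B : VCat a b) : Set (a ⊔ b ⊔ ℓ₂) where
    private
      module A = VCat A
      module B = VCat B
    field
      map : Func A.X B.X
    open Func map public using (to; cong)
    field
      nonexpansive : ∀ x y → A.d x y V.≤ B.d (to x) (to y)

  DPMet : ∀ a b → Category (suc (a ⊔ b) ⊔ c ⊔ ℓ₁ ⊔ ℓ₂) (a ⊔ b ⊔ ℓ₂) (a ⊔ b)
  DPMet a b = record
    { Obj = VCat a b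
    ; _⇒_ = VFunctor
    ; _≈_ = λ {A} {B} f g → ∀ x → VCat._≈_ B (to f x) (to g x)
    ; id = λ {A} → record
      { map = Identity.function (X A) ; nonexpansive = λ x y → ≤-refl }
    ; _∘_ = λ g f → record
      { map = Composition.function (map f) (map g)
      ; nonexpansive = λ x y →
          ≤-trans (nonexpansive f x y) (nonexpansive g (to f x) (to f y))
      }
    ; equiv = λ {A} {B} → record
      { refl = λ x → refl≈ B
      ; sym = λ p x → sym≈ B (p x)
      ; trans = λ p q x → trans≈ B (p x) (q x)
      }
    ; ∘-resp-≈ = λ {_} {_} {D} {f} {f′} {g} {g′} p q x →
        trans≈ D (cong f (q x)) (p (to g′ x))
    ; identityˡ = λ {A} {B} x → refl≈ B
    ; identityʳ = λ {A} {B} x → refl≈ B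
    ; assoc = λ {A} {B} {D} {E} x → refl≈ E
    }
    where
      open VCat using (X)
      open VFunctor
      open IsPartialOrder V.isPartialOrder using () renaming (refl to ≤-refl; trans to ≤-trans)
      refl≈ = λ (B : VCat a b) {x} → Setoid.refl (X B) {x}
      sym≈ = λ (B : VCat a b) {x y} → Setoid.sym (X B) {x} {y}
      trans≈ = λ (B : VCat a b) {x y z} → Setoid.trans (X B) {x} {y} {z}

  PMet : ∀ a b → Category (suc (a ⊔ b) ⊔ c ⊔ ℓ₁ ⊔ ℓ₂) (a ⊔ b ⊔ ℓ₂) (a ⊔ b)
  PMet a b = FullSubcategory (DPMet a b) Symmetric

  Met : ∀ a b → Category (suc (a ⊔ b) ⊔ c ⊔ ℓ₁ ⊔ ℓ₂) (a ⊔ b ⊔ ℓ₂) (a ⊔ b)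
  Met a b = FullSubcategory (DPMet a b) (λ A → Symmetric A × Separated A)

  ⟦_⟧ : MetricCategory → ∀ a b → Category (suc (a ⊔ b) ⊔ c ⊔ ℓ₁ ⊔ ℓ₂) (a ⊔ b ⊔ ℓ₂) (a ⊔ b)
  ⟦ dpmet ⟧ = DPMet
  ⟦ pmet  ⟧ = PMet
  ⟦ met   ⟧ = Met

{-# OPTIONS --safe #-}

-- The argument is valid over any category: ev_λ is λ · Fη_Ω.  Coequalization and
-- the unit laws give λ · Fη · Fo = λ · FTo · FηT = λ · Fμ · FηT = λ, while
-- homomorphy of λ and naturality of ζ give that ev_λ is a homomorphism.

module Submission where

open import Defs
open import Level using (Level)
open import Data.Product.Base using (_×_; _,_; ∃-syntax)

module _ {ℓ₁ ℓ₂ ℓ₃ : Level} {C : Category ℓ₁ ℓ₂ ℓ₃} {M : Monad C} {F : Endofunctor C}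
         (law : EMLaw M F) (Ωo : Algebra M) where
  open Category C
  open Monad M
  open Functor F
  open EMLaw law
  open Algebra Ωo renaming (carrier to Ω; act to o; act-unit to o-unit; act-mult to o-mult)
  open HomReasoning
  private
    module T = Functor T
    F̃Ω = Functor.F₀ (lifting law) Ωo
    module 𝕄 = GradedMonad (gradedMonad law)

  -- The recursion defining `graded-μ` starts from `ζ⁽⁰⁾ = id` and so leaves identity factors
  -- behind. This equation and the next two strip them, giving the usual forms of the
  -- multiplications in the algebra laws.
  μ⁰⁰ : ∀ {A} → 𝕄.μ 0 0 A ≈ μ A
  μ⁰⁰ = identityʳ

  μ⁰¹ : ∀ {A} → 𝕄.μ 0 1 A ≈ F₁ (μ A) ∘ ζ (T₀ A)
  μ⁰¹ = ∘-congˡ (Equiv.trans (∘-congʳ identity) identityˡ)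

  μ¹⁰ : ∀ {A} → 𝕄.μ 1 0 A ≈ F₁ (μ A)
  μ¹⁰ = F-resp-≈ identityʳ

  module _ {lam : F₀ (T₀ Ω) ⇒ Ω} (modal : IsModalOperator law Ωo lam) where
    open IsM₁Algebra modal

    private
      ev : F₀ Ω ⇒ Ω
      ev = lam ∘ F₁ (η Ω)

    modal-factor : lam ≈ ev ∘ F₁ o
    modal-factor = Equiv.sym (begin
      (lam ∘ F₁ (η Ω)) ∘ F₁ o           ≈⟨ assoc ⟩
      lam ∘ (F₁ (η Ω) ∘ F₁ o)           ≈⟨ ∘-congˡ (F-square (η-natural o)) ⟩
      -- Coequalization is read from right to left: it trades `F₁ (T₁ o)` for the multiplication,
      -- which then cancels against `η (T₀ Ω)`.
      lam ∘ (F₁ (T₁ o) ∘ F₁ (η (T₀ Ω))) ≈⟨ extendʳ coequalization ⟨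
      lam ∘ (𝕄.μ 1 0 Ω ∘ F₁ (η (T₀ Ω))) ≈⟨ ∘-congˡ (∘-congʳ μ¹⁰) ⟩
      lam ∘ (F₁ (μ Ω) ∘ F₁ (η (T₀ Ω)))  ≈⟨ ∘-congˡ homomorphism ⟨
      lam ∘ F₁ (μ Ω ∘ η (T₀ Ω))         ≈⟨ ∘-congˡ (F-resp-≈ μ-identityʳ) ⟩
      lam ∘ F₁ id                       ≈⟨ ∘-congˡ identity ⟩
      lam ∘ id                          ≈⟨ identityʳ ⟩
      lam                               ∎)

    modal-evaluation : AlgebraHom F̃Ω Ωo
    modal-evaluation = record
      { hom = ev
      ; preserve = begin
          ev ∘ (F₁ o ∘ ζ Ω)                         ≈⟨ pullˡ (Equiv.sym modal-factor) ⟩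
          -- Homomorphy speaks of `lam` followed on the right by `F₁ (μ Ω) ∘ ζ (T₀ Ω)`. To create
          -- this shape, the identity is expanded by the unit law for `T₁ (η Ω)`, not the one for
          -- `η (T₀ Ω)` as in `modal-factor`.
          lam ∘ ζ Ω                                 ≈⟨ ∘-congˡ identityˡ ⟨
          lam ∘ (id ∘ ζ Ω)                          ≈⟨ ∘-congˡ (∘-congʳ identity) ⟨
          lam ∘ (F₁ id ∘ ζ Ω)                       ≈⟨ ∘-congˡ (∘-congʳ (F-resp-≈ μ-identityˡ)) ⟨
          lam ∘ (F₁ (μ Ω ∘ T₁ (η Ω)) ∘ ζ Ω)         ≈⟨ ∘-congˡ (∘-congʳ homomorphism) ⟩
          lam ∘ ((F₁ (μ Ω) ∘ F₁ (T₁ (η Ω))) ∘ ζ Ω)  ≈⟨ ∘-congˡ assoc ⟩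
          -- Naturality at `η Ω` replaces `ζ Ω` by `ζ (T₀ Ω)` and leaves `T₁ (F₁ (η Ω))`, which
          -- later merges with `T₁ lam` into `T₁ ev`.
          lam ∘ (F₁ (μ Ω) ∘ (F₁ (T₁ (η Ω)) ∘ ζ Ω))  ≈⟨ ∘-congˡ (∘-congˡ (ζ-natural (η Ω))) ⟨
          lam ∘ (F₁ (μ Ω) ∘ (ζ _ ∘ T₁ (F₁ (η Ω))))  ≈⟨ ∘-congˡ (pullˡ (Equiv.sym μ⁰¹)) ⟩
          lam ∘ (𝕄.μ 0 1 Ω ∘ T₁ (F₁ (η Ω)))         ≈⟨ extendʳ homomorphy ⟩
          o ∘ (T₁ lam ∘ T₁ (F₁ (η Ω)))              ≈⟨ ∘-congˡ T.homomorphism ⟨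
          o ∘ T₁ ev                                 ∎
      }

  hom-modal : (e : AlgebraHom F̃Ω Ωo) → IsModalOperator law Ωo (AlgebraHom.hom e ∘ F₁ o)
  hom-modal e = record
    { unit⁰ = o-unit
    ; unit¹ = o-unit
    ; assoc⁰ = o-assoc
    ; assoc¹ = o-assoc
    ; homomorphy = begin
        (hom ∘ F₁ o) ∘ 𝕄.μ 0 1 Ω                 ≈⟨ ∘-congˡ μ⁰¹ ⟩
        (hom ∘ F₁ o) ∘ (F₁ (μ Ω) ∘ ζ (T₀ Ω))     ≈⟨ assoc ⟩
        -- Associativity of `o` under `F` makes naturality of `ζ` at `o` applicable; this exposes
        -- `F₁ o ∘ ζ Ω`, the action of the lifted algebra, to which `preserve` applies.
        hom ∘ (F₁ o ∘ (F₁ (μ Ω) ∘ ζ (T₀ Ω)))     ≈⟨ ∘-congˡ (extendʳ (F-square o-mult)) ⟩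
        hom ∘ (F₁ o ∘ (F₁ (T₁ o) ∘ ζ (T₀ Ω)))    ≈⟨ ∘-congˡ (∘-congˡ (ζ-natural o)) ⟨
        hom ∘ (F₁ o ∘ (ζ Ω ∘ T₁ (F₁ o)))         ≈⟨ ∘-congˡ assoc ⟨
        hom ∘ ((F₁ o ∘ ζ Ω) ∘ T₁ (F₁ o))         ≈⟨ extendʳ preserve ⟩
        o ∘ (T₁ hom ∘ T₁ (F₁ o))                 ≈⟨ ∘-congˡ T.homomorphism ⟨
        o ∘ T₁ (hom ∘ F₁ o)                      ∎
    ; coequalization = begin
        (hom ∘ F₁ o) ∘ 𝕄.μ 1 0 Ω     ≈⟨ ∘-congˡ μ¹⁰ ⟩
        (hom ∘ F₁ o) ∘ F₁ (μ Ω)      ≈⟨ assoc ⟩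
        -- `o` already coequalizes `μ Ω` and `T₁ o`, and `F` preserves this equation.
        hom ∘ (F₁ o ∘ F₁ (μ Ω))      ≈⟨ ∘-congˡ (F-square o-mult) ⟩
        hom ∘ (F₁ o ∘ F₁ (T₁ o))     ≈⟨ assoc ⟨
        (hom ∘ F₁ o) ∘ F₁ (T₁ o)     ∎
    }
    where
      open AlgebraHom e
      o-assoc : o ∘ 𝕄.μ 0 0 Ω ≈ o ∘ T₁ o
      o-assoc = Equiv.trans (∘-congˡ μ⁰⁰) o-mult

theorem30 :
    ∀ {c ℓ₁ ℓ₂ ι a b : Level} (𝒱 : Quantale c ℓ₁ ℓ₂ ι) (𝒦 : MetricCategory) →
    let C = ⟦_⟧ 𝒱 𝒦 a b
        open Category C
    in
    (F : Endofunctor C) (T : Monad C) (ζ : EMLaw T F) (Ωo : Algebra T) →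
    let open Functor F
        F̃ = lifting ζ
        Ω = Algebra.carrier Ωo
        o = Algebra.act Ωo
    in
    (∀ (lam : F₀ (Monad.T₀ T Ω) ⇒ Ω) → IsModalOperator ζ Ωo lam →
       ∃[ ev ] lam ≈ AlgebraHom.hom {A = Functor.F₀ F̃ Ωo} {B = Ωo} ev ∘ F₁ o)
    ×
    (∀ (e : AlgebraHom (Functor.F₀ F̃ Ωo) Ωo) →
       IsModalOperator ζ Ωo (AlgebraHom.hom e ∘ F₁ o))
theorem30 𝒱 𝒦 F T ζ Ωo =
  (λ lam modal → modal-evaluation ζ Ωo modal , modal-factor ζ Ωo modal) , hom-modal ζ Ωo
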